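{- Let $u$ be a non-trivial u-p-word for $n$-permutations, and let $f$ be the number of occurrences of $\Diamond$ in $u$. Then $n\leq 3f+1$.
   Context: An $n$-permutation is a permutation of $\{1,\ldots,n\}$. For a word $w$ of distinct numbers, $\mathrm{red}(w)$ is obtained by replacing the $i$-th smallest letter by $i$. Let $\Diamond$ be a symbol not among the integers. A word $f_1\cdots f_n$ over the positive integers together with $\Diamond$, whose integer letters are pairwise distinct, covers an $n$-permutation $\pi$ if one can substitute real numbers for the occurrences of $\Diamond$ (independently) so that the resulting word has $n$ pairwise distinct entries and reduces to $\pi$; equivalently, $f_i<f_j\iff\pi_i<\pi_j$ for all positions $i,j$ holding integers. A u-p-word for $n$-permutations is a word $u_1\cdots u_N$, $N\geq n$, over this alphabet containing at least one $\Diamond$, such that every factor $u_i\cdots u_{i+n-1}$ ($1\leq i\leq N-n+1$) has pairwise distinct integer letters and every $n$-permutation is covered by exactly one of these factors. A u-p-word is trivial if all of its letters are $\Diamond$. -}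

module Defs where

open import Data.Fin.Base using (Fin; inject≤; _↑ʳ_) renaming (_<_ to _<ᶠ_)
open import Data.Fin.Permutation using (Permutation′; _⟨$⟩ʳ_)
open import Data.Nat.Base using (ℕ; _+_; _≤_; _<_; NonZero)
open import Data.Product using (∃!)
open import Data.Vec.Base using (Vec; lookup; tabulate; count)
open import Data.Vec.Membership.Propositional using (_∈_)
open import Data.Vec.Relation.Unary.All using (All)
open import Function.Bundles using (_⇔_)
open import Relation.Binary.PropositionalEquality.Core using (_≡_; refl)
open import Relation.Nullary.Decidable.Core using (Dec; yes; no)

data Letter : Set where
  ◇   : Letter
  int : (k : ℕ) → .{{NonZero k}} → Letter

≡◇? : (x : Letter) → Dec (x ≡ ◇)
≡◇? ◇       = yes refl
≡◇? (int _) = no λ ()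

DistinctIntegers : ∀ {n} → Vec Letter n → Set
DistinctIntegers w =
  ∀ j k a .{{_ : NonZero a}} →
  lookup w j ≡ int a → lookup w k ≡ int a → j ≡ k

-- Permutations are on {0,…,n-1}; the j-th entry π_j of the one-line notation
-- is π ⟨$⟩ʳ j. Some substitution of real numbers for the ◇s of w reduces to π
-- exactly when the integer letters of w are ordered as π is at their positions.
Covers : ∀ {n} → Vec Letter n → Permutation′ n → Set
Covers w π =
  ∀ j k a b .{{_ : NonZero a}} .{{_ : NonZero b}} →
  lookup w j ≡ int a → lookup w k ≡ int b →
  (a < b) ⇔ ((π ⟨$⟩ʳ j) <ᶠ (π ⟨$⟩ʳ k))

-- Starting points (from 0) of the length-n factors of a word of length N.
-- The bound is irrelevant, so two of them are equal as soon as their starts are.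
record Position (n N : ℕ) : Set where
  constructor position
  field
    start : ℕ
    .fits : start + n ≤ N

factor : ∀ {n N} → Vec Letter N → Position n N → Vec Letter n
factor u (position i i+n≤N) = tabulate λ j → lookup u (inject≤ (i ↑ʳ j) i+n≤N)

record IsUPWord (n : ℕ) {N : ℕ} (u : Vec Letter N) : Set where
  field
    n≤N              : n ≤ N
    containsDiamond  : ◇ ∈ u
    distinctIntegers : (i : Position n N) → DistinctIntegers (factor u i)
    coveredOnce      : (π : Permutation′ n) →
                       ∃! _≡_ λ (i : Position n N) → Covers (factor u i) π

Trivial : ∀ {N} → Vec Letter N → Set
Trivial = All (_≡ ◇)

#◇ : ∀ {N} → Vec Letter N → ℕ
#◇ = count ≡◇?

{-# OPTIONS --safe #-}

-- Suppose n ≥ 3f + 2. If u_p = ◇, then the factor at p covers all left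
-- extensions of each pattern covered by the n - 1 letters after p; so such a
-- pattern can recur only at the beginning of u, and its right extensions are
-- shared by at most two factors. A factor ending in an integer covers too few
-- of them (it has at most f diamonds), hence u_{p+n} = ◇, and likewise u_{p-n}
-- = ◇. Diamonds thus recur with period n, so |u| < (f + 1) n and u has at most
-- f n factors. A permutation is determined by the factor covering it and its
-- values at the diamonds, so n! ≤ f n · n^f, which contradicts (n!)² ≥ n^n ≥
-- n^(3f+2).
module Submission where

open import Data.Nat.Base using (ℕ; _+_; _*_; _≤_)
open import Data.Vec.Base using (Vec)
open import Relation.Nullary.Negation.Core using (¬_)
open import Defs

open import Data.Empty using (⊥; ⊥-elim)
open import Data.Fin.Base as Fin using (Fin; zero; suc; toℕ; fromℕ; fromℕ<; punchIn; punchOut; combine; quotient; remainder; funToFin; finToFun)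
open import Data.Fin.Patterns using (0F; 1F; 2F)
open import Data.Fin.Permutation using (Permutation′; _⟨$⟩ʳ_; _⟨$⟩ˡ_; inverseˡ; inverseʳ; insert; insert-punchIn) renaming (id to idₚ; _≈_ to _≈ₚ_)
open import Data.Fin.Properties as Fin using (toℕ-injective; toℕ<n; toℕ-fromℕ<; toℕ-fromℕ; fromℕ<-injective; punchIn-punchOut; punchIn-injective; punchIn-mono-≤; punchIn-cancel-≤; combine-injective; combine-remQuot; finToFun-funToFin; injective⇒≤)
open import Data.Nat.Base using (zero; suc; _<_; _∸_; _^_; _!; _/_; _%_; _⊔_; NonZero; >-nonZero; z≤n; s≤s; z<s)
open import Data.Nat.DivMod using (_mod_; m≡m%n+[m/n]*n; m%n<n; m<n⇒m%n≡m)
open import Data.Nat.Induction using (<-rec)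
open import Data.Nat.Properties
open import Data.Nat.Tactic.RingSolver using (solve-∀)
open import Data.Product using (Σ; ∃; _×_; _,_; proj₁; proj₂)
open import Data.Sum.Base using (_⊎_; inj₁; inj₂)
open import Data.Vec.Base using ([]; _∷_; lookup)
open import Data.Vec.Properties using (lookup∘tabulate)
open import Data.Vec.Relation.Unary.Any using (index)
open import Data.Vec.Relation.Unary.Any.Properties using (lookup-index)
open import Function.Base using (_∘_; _$_; case_of_)
open import Function.Bundles using (_⇔_; mk⇔; Equivalence)
open import Function.Definitions using (Injective)
open import Relation.Binary.Definitions using (tri<; tri≈; tri>)
open import Relation.Binary.PropositionalEquality
open import Relation.Nullary.Decidable using (Dec; yes; no; recompute)
open import Relation.Nullary.Negation using (contradiction)
open import Relation.Unary using (Decidable)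

open Equivalence using (to; from)

private
  variable
    m n N : ℕ

  -- With functions, deleting the letter at `s` is composition with `punchIn s`. `Distinct` and
  -- `_covers_` are what `DistinctIntegers` and `Covers` unfold to when the function is the `lookup`
  -- of a vector.
  Word : ℕ → Set
  Word n = Fin n → Letter

  Distinct : Word n → Set
  Distinct w =
    ∀ j k a .{{_ : NonZero a}} → w j ≡ int a → w k ≡ int a → j ≡ k

  _covers_ : Word n → Permutation′ n → Set
  w covers π =
    ∀ j k a b .{{_ : NonZero a}} .{{_ : NonZero b}} →
    w j ≡ int a → w k ≡ int b → (a < b) ⇔ ((π ⟨$⟩ʳ j) Fin.< (π ⟨$⟩ʳ k))

int-injective : ∀ {a b} .{{_ : NonZero a}} .{{_ : NonZero b}} → int a ≡ int b → a ≡ b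
int-injective refl = refl

-- Inserting one value into a permutation

punchIn-below : ∀ (c : Fin (suc n)) j → toℕ j < toℕ c → toℕ (punchIn c j) ≡ toℕ j
punchIn-below (suc c) zero    _         = refl
punchIn-below (suc c) (suc j) (s≤s j<c) = cong suc (punchIn-below c j j<c)

punchIn-above : ∀ (c : Fin (suc n)) j → toℕ c ≤ toℕ j → toℕ (punchIn c j) ≡ suc (toℕ j)
punchIn-above zero    j       _         = refl
punchIn-above (suc c) (suc j) (s≤s c≤j) = cong suc (punchIn-above c j c≤j)

punchIn<⇔ : ∀ (c : Fin (suc n)) j → (toℕ j < toℕ c) ⇔ (toℕ (punchIn c j) < toℕ c)
punchIn<⇔ c j = mk⇔
  (λ j<c → subst (_< toℕ c) (sym (punchIn-below c j j<c)) j<c)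
  (λ p → ≰⇒> λ c≤j → <⇒≱ (subst (_< toℕ c) (punchIn-above c j c≤j) p) (m≤n⇒m≤1+n c≤j))

<punchIn⇔ : ∀ (c : Fin (suc n)) j → (toℕ c ≤ toℕ j) ⇔ (toℕ c < toℕ (punchIn c j))
<punchIn⇔ c j = mk⇔
  (λ c≤j → subst (toℕ c <_) (sym (punchIn-above c j c≤j)) (s≤s c≤j))
  (λ p → ≮⇒≥ λ j<c → <-asym p (to (punchIn<⇔ c j) j<c))

punchIn-mono⇔ : ∀ (c : Fin (suc n)) i j → (i Fin.< j) ⇔ (punchIn c i Fin.< punchIn c j)
punchIn-mono⇔ c i j = mk⇔
  (λ i<j → ≰⇒> λ p → <⇒≱ i<j (punchIn-cancel-≤ c j i p))
  (λ p → ≰⇒> λ j≤i → <⇒≱ p (punchIn-mono-≤ c j i j≤i))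

insert-at : ∀ s (c : Fin (suc n)) (τ : Permutation′ n) → insert s c τ ⟨$⟩ʳ s ≡ c
insert-at s c τ with s Fin.≟ s
... | yes _  = refl
... | no s≢s = contradiction refl s≢s

punchIn-view : ∀ (s j : Fin (suc n)) → j ≡ s ⊎ ∃ λ i → j ≡ punchIn s i
punchIn-view s j with s Fin.≟ j
... | yes s≡j = inj₁ (sym s≡j)
... | no  s≢j = inj₂ (punchOut s≢j , sym (punchIn-punchOut s≢j))

module _ {w : Word (suc n)} {s c : Fin (suc n)} {τ : Permutation′ n} where

  private
    ρ = insert s c τ

  -- Comparisons inside `τ` survive because `punchIn c` is strictly monotone, so only those with the
  -- letter at `s` remain. One side is strict and the other weak because `c` marks a gap between
  -- values of `τ`: the values from `c` on move up by one.
  covers-insert :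
    (w ∘ punchIn s) covers τ →
    (∀ j a b .{{_ : NonZero a}} .{{_ : NonZero b}} → w s ≡ int a → w (punchIn s j) ≡ int b →
      (b < a × toℕ (τ ⟨$⟩ʳ j) < toℕ c) ⊎ (a < b × toℕ c ≤ toℕ (τ ⟨$⟩ʳ j))) →
    w covers ρ
  covers-insert cov new i j a b wi wj with punchIn-view s i | punchIn-view s j
  ... | inj₁ refl | inj₁ refl
    with refl ← int-injective (trans (sym wi) wj) =
    mk⇔ (⊥-elim ∘ <-irrefl refl) (⊥-elim ∘ <-irrefl refl)
  ... | inj₁ refl | inj₂ (j′ , refl)
    rewrite insert-at s c τ | insert-punchIn s c τ j′ with new j′ a b wi wj
  ...   | inj₁ (b<a , τj<c) = mk⇔ (⊥-elim ∘ <-asym b<a)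
            (λ p → contradiction τj<c (≤⇒≯ (from (<punchIn⇔ c _) p)))
  ...   | inj₂ (a<b , c≤τj) = mk⇔ (λ _ → to (<punchIn⇔ c _) c≤τj) (λ _ → a<b)
  covers-insert cov new i j a b wi wj | inj₂ (i′ , refl) | inj₁ refl
    rewrite insert-at s c τ | insert-punchIn s c τ i′ with new i′ b a wj wi
  ...   | inj₁ (a<b , τi<c) = mk⇔ (λ _ → to (punchIn<⇔ c _) τi<c) (λ _ → a<b)
  ...   | inj₂ (b<a , c≤τi) = mk⇔ (⊥-elim ∘ <-asym b<a)
            (λ p → contradiction (from (punchIn<⇔ c _) p) (≤⇒≯ c≤τi))
  covers-insert cov new i j a b wi wj | inj₂ (i′ , refl) | inj₂ (j′ , refl)
    rewrite insert-punchIn s c τ i′ | insert-punchIn s c τ j′ = mk⇔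
      (to (punchIn-mono⇔ c _ _) ∘ to (cov i′ j′ a b wi wj))
      (from (cov i′ j′ a b wi wj) ∘ from (punchIn-mono⇔ c _ _))

  -- A diamond takes part in no comparison, which leaves the new value `c` arbitrary.
  covers-insert-◇ : w s ≡ ◇ → (w ∘ punchIn s) covers τ → w covers ρ
  covers-insert-◇ ws≡◇ cov = covers-insert cov λ _ _ _ ws _ → case trans (sym ws≡◇) ws of λ ()

  covers-delete : w covers ρ → (w ∘ punchIn s) covers τ
  covers-delete cov i j a b wi wj
    with eqv ← cov (punchIn s i) (punchIn s j) a b wi wj
    rewrite insert-punchIn s c τ i | insert-punchIn s c τ j = mk⇔
      (from (punchIn-mono⇔ c _ _) ∘ to eqv) (from eqv ∘ to (punchIn-mono⇔ c _ _))

  covers-compare : w covers ρ → ∀ j a b .{{_ : NonZero a}} .{{_ : NonZero b}} →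
    w s ≡ int a → w (punchIn s j) ≡ int b → (b < a) ⇔ (toℕ (τ ⟨$⟩ʳ j) < toℕ c)
  covers-compare cov j a b ws wj
    with eqv ← cov (punchIn s j) s b a wj ws
    rewrite insert-at s c τ | insert-punchIn s c τ j = mk⇔
      (from (punchIn<⇔ c _) ∘ to eqv) (from eqv ∘ to (punchIn<⇔ c _))

covers-cong : {w w′ : Word n} {π : Permutation′ n} → w ≗ w′ → w covers π → w′ covers π
covers-cong eq cov j k a b wj wk = cov j k a b (trans (eq j) wj) (trans (eq k) wk)

-- Extending a covered pattern by one letter

strict-sup : {A : Fin m → Set} → Decidable A → (v : Fin m → ℕ) →
  ∃ λ c → (∀ i → A i → v i < c) × (∀ b → (∀ i → A i → v i < b) → c ≤ b)
strict-sup {zero}  A? v = 0 , (λ ()) , λ _ _ → z≤n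
strict-sup {suc m} A? v with strict-sup (A? ∘ suc) (v ∘ suc) | A? zero
... | c , upper , least | yes a = suc (v zero) ⊔ c
  , (λ { zero _ → m≤m⊔n _ c ; (suc i) a′ → ≤-trans (upper i a′) (m≤n⊔m _ c) })
  , λ b ub → ⊔-lub (ub zero a) (least b (ub ∘ suc))
... | c , upper , least | no ¬a = c
  , (λ { zero a → contradiction a ¬a ; (suc i) a′ → upper i a′ })
  , λ b ub → least b (ub ∘ suc)

-- A diamond lies below no integer, so values at diamonds do not enter the supremum in `extend`.
_<ₗ_ : Letter → ℕ → Set
◇     <ₗ a = ⊥
int b <ₗ a = b < a

_<ₗ?_ : ∀ x a → Dec (x <ₗ a)
◇     <ₗ? a = no λ ()
int b <ₗ? a = b <? a

module _ (w : Word (suc n)) (s : Fin (suc n)) (τ : Permutation′ n) where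

  -- For an integer at `s`, the new value is the least strict upper bound of the values of `τ` at
  -- smaller integer letters; it is at most `n` because `n` is such a bound.
  extend : Distinct w → (w ∘ punchIn s) covers τ → ∃ λ c → w covers (insert s c τ)
  extend dist cov with w s in ws
  ... | ◇     = zero , covers-insert-◇ ws cov
  ... | int a with strict-sup (λ j → w (punchIn s j) <ₗ? a) (λ j → toℕ (τ ⟨$⟩ʳ j))
  ...   | c , upper , least = fromℕ< c<1+n , covers-insert cov compare
    where
    c<1+n : c < suc n
    c<1+n = s≤s (least n λ i _ → toℕ<n (τ ⟨$⟩ʳ i))

    compare : ∀ j a′ b .{{_ : NonZero a′}} .{{_ : NonZero b}} → w s ≡ int a′ → w (punchIn s j) ≡ int b →
      (b < a′ × toℕ (τ ⟨$⟩ʳ j) < toℕ (fromℕ< c<1+n)) ⊎ (a′ < b × toℕ (fromℕ< c<1+n) ≤ toℕ (τ ⟨$⟩ʳ j))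
    compare j a′ b ws′ wj rewrite toℕ-fromℕ< c<1+n
      with refl ← int-injective (trans (sym ws) ws′) with <-cmp b a
    ... | tri< b<a _ _ = inj₁ (b<a , upper j (subst (_<ₗ a) (sym wj) b<a))
    ... | tri≈ _ refl _ = contradiction (dist (punchIn s j) s b wj ws) (Fin.punchInᵢ≢i s j)
    -- As `τ` is covered, its value at the larger letter `b` exceeds its values at all letters below
    -- `a`, hence is itself an upper bound.
    ... | tri> _ _ a<b = inj₂ (a<b , least _ λ i wi<a → smaller i wi<a)
      where
      smaller : ∀ i → w (punchIn s i) <ₗ a → toℕ (τ ⟨$⟩ʳ i) < toℕ (τ ⟨$⟩ʳ j)
      smaller i wi<a with w (punchIn s i) in wi
      ... | int e = to (cov i j e b wi wj) (<-trans wi<a a<b)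

some-covered : (w : Word n) → Distinct w → ∃ λ π → w covers π
some-covered {zero}  w dist = idₚ , λ ()
some-covered {suc n} w dist
  with τ , cov ← some-covered (w ∘ suc) (λ j k a wj wk → Fin.suc-injective (dist _ _ a wj wk))
  with c , cov′ ← extend w zero τ dist cov = insert zero c τ , cov′

-- Diamonds propagate with period n

-- `Pos` is abstract so that one argument moves diamonds both ways: `s` and `t` will be the first
-- and last positions, in either order.
module _ {Pos : Set} {k : ℕ} (W : Pos → Word (suc k))
  (distinct : ∀ i → Distinct (W i))
  (covering : ∀ π → ∃ λ i → W i covers π)
  (unique : ∀ π {i j} → W i covers π → W j covers π → i ≡ j)
  {f : ℕ} (few : ∀ i (g : Fin (suc f) → Fin (suc k)) → Injective _≡_ _≡_ g → ¬ (∀ r → W i (g r) ≡ ◇))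
  (f-small : suc f + suc f ≤ k)
  where

  -- A word whose letter at s is an integer pins the value at s down to an
  -- interval that contains only values taken at diamonds.
  covered-insertions-close : ∀ i s τ (c d : Fin (suc k)) → toℕ c + suc f ≤ toℕ d →
    W i covers (insert s c τ) → W i covers (insert s d τ) → W i s ≡ ◇
  covered-insertions-close i s τ c d gap covc covd with W i s in ws
  ... | ◇     = refl
  ... | int a = contradiction all◇ (few i g g-injective)
    where
    v<d : ∀ r → toℕ c + toℕ r < toℕ d
    v<d r = <-≤-trans (+-monoʳ-< (toℕ c) (toℕ<n r)) gap

    v<k : ∀ r → toℕ c + toℕ r < k
    v<k r = <-≤-trans (v<d r) (≤-pred (toℕ<n d))

    -- The positions where `τ` takes the f + 1 values c, ..., c + f, all below `d`. Diamonds at all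
    -- of them would be one too many.
    h : Fin (suc f) → Fin k
    h r = τ ⟨$⟩ˡ fromℕ< (v<k r)

    τh : ∀ r → toℕ (τ ⟨$⟩ʳ h r) ≡ toℕ c + toℕ r
    τh r = trans (cong toℕ (inverseʳ τ)) (toℕ-fromℕ< (v<k r))

    g : Fin (suc f) → Fin (suc k)
    g r = punchIn s (h r)

    g-injective : Injective _≡_ _≡_ g
    g-injective {r} {r′} eq = toℕ-injective $ +-cancelˡ-≡ (toℕ c) _ _ $
      trans (sym (τh r)) (trans (cong (λ j → toℕ (τ ⟨$⟩ʳ j)) (punchIn-injective s _ _ eq)) (τh r′))

    all◇ : ∀ r → W i (g r) ≡ ◇
    all◇ r with W i (g r) in wg
    ... | ◇     = refl
    ... | int b = contradiction (subst (_< toℕ c) (τh r) τ<c) (m+n≮m (toℕ c) (toℕ r))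
      where
      -- Were there an integer `b`, inserting `d` would force b < a, and then inserting `c` would
      -- force c + r < c.
      b<a : b < a
      b<a = from (covers-compare covd (h r) a b ws wg) (subst (_< toℕ d) (sym (τh r)) (v<d r))

      τ<c : toℕ (τ ⟨$⟩ʳ h r) < toℕ c
      τ<c = to (covers-compare covc (h r) a b ws wg) b<a

  -- Let τ be covered by the letters shared by W x and W x′. Since W x′ covers
  -- all insertions at t, no word but W x and W e (the one without a neighbour)
  -- covers an insertion into τ at s; yet there are three insertions far from each other.
  diamond-propagates : ∀ s t x x′ e →
    W x ∘ punchIn s ≗ W x′ ∘ punchIn t → W x′ t ≡ ◇ →
    (∀ i → i ≡ e ⊎ ∃ λ i′ → (W i ∘ punchIn s ≗ W i′ ∘ punchIn t) × (i′ ≡ x′ → i ≡ x)) →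
    W x s ≡ ◇
  diamond-propagates s t x x′ e shared x′t≡◇ next
    -- The insertion of `c` is one that `W x` certainly covers; it serves to recognise `x` in
    -- `both`.
    with τ , covτ ← some-covered (W x ∘ punchIn s)
                      (λ i j a wi wj → punchIn-injective s i j (distinct x _ _ a wi wj))
    with c , covc ← extend (W x) s τ (distinct x) covτ
    = three (locate 0F) (locate 1F) (locate 2F)
    where
    -- The inserted values 0, f + 1 and 2(f + 1) have gaps of at least f + 1, and `f-small` keeps
    -- the largest within `k`.
    value : Fin 3 → ℕ
    value r = toℕ r * suc f

    value<1+k : ∀ r → value r < suc k
    value<1+k r = s≤s (≤-trans (*-monoˡ-≤ (suc f) (≤-pred (toℕ<n r)))
      (subst (_≤ k) (cong (suc f +_) (sym (+-identityʳ (suc f)))) f-small))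

    C : Fin 3 → Fin (suc k)
    C r = fromℕ< (value<1+k r)

    locate : ∀ r → (W x covers insert s (C r) τ) ⊎ (W e covers insert s (C r) τ)
    -- If `i` has a neighbour `i′`, then `W i′` covers some insertion into `τ` at `t`. So does
    -- `W x′`, by its diamond; uniqueness gives i′ = x′, hence i = x.
    locate r with i , cov ← covering (insert s (C r) τ) with next i
    ... | inj₁ refl = inj₂ cov
    ... | inj₂ (i′ , eq , back)
      with covτ′ ← covers-cong {π = τ} eq (covers-delete {τ = τ} cov)
      with d , covd ← extend (W i′) t τ (distinct i′) covτ′
      with refl ← back (unique (insert t d τ) covd (covers-insert-◇ {τ = τ} x′t≡◇ (covers-cong {π = τ} shared covτ)))
      = inj₁ cov

    both : ∀ i r r′ → toℕ r < toℕ r′ →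
      W i covers insert s (C r) τ → W i covers insert s (C r′) τ → W x s ≡ ◇
    both i r r′ r<r′ cov cov′ =
      -- With a diamond at `s`, `W i` also covers the insertion of `c`, which belongs to `W x`; so i
      -- = x even when `i` was given as `e`.
      subst (λ j → W j s ≡ ◇) (unique (insert s c τ) (covers-insert-◇ {τ = τ} is≡◇ (covers-delete {τ = τ} cov)) covc) is≡◇
      where
      gap : toℕ (C r) + suc f ≤ toℕ (C r′)
      gap = begin
        toℕ (C r) + suc f   ≡⟨ cong (_+ suc f) (toℕ-fromℕ< (value<1+k r)) ⟩
        value r + suc f     ≡⟨ +-comm (value r) (suc f) ⟩
        suc (toℕ r) * suc f ≤⟨ *-monoˡ-≤ (suc f) r<r′ ⟩
        value r′            ≡⟨ toℕ-fromℕ< (value<1+k r′) ⟨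
        toℕ (C r′)          ∎
        where open ≤-Reasoning

      is≡◇ : W i s ≡ ◇
      is≡◇ = covered-insertions-close i s τ (C r) (C r′) gap cov cov′

    -- Pigeonhole: two of the three insertions are assigned to the same word.
    three : (W x covers insert s (C 0F) τ) ⊎ (W e covers insert s (C 0F) τ) →
            (W x covers insert s (C 1F) τ) ⊎ (W e covers insert s (C 1F) τ) →
            (W x covers insert s (C 2F) τ) ⊎ (W e covers insert s (C 2F) τ) → W x s ≡ ◇
    three (inj₁ p) (inj₁ q) _        = both x 0F 1F (s≤s z≤n) p q
    three (inj₂ p) (inj₂ q) _        = both e 0F 1F (s≤s z≤n) p q
    three (inj₁ p) (inj₂ q) (inj₁ r) = both x 0F 2F (s≤s z≤n) p r
    three (inj₁ p) (inj₂ q) (inj₂ r) = both e 1F 2F (s≤s (s≤s z≤n)) q r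
    three (inj₂ p) (inj₁ q) (inj₁ r) = both x 1F 2F (s≤s (s≤s z≤n)) q r
    three (inj₂ p) (inj₁ q) (inj₂ r) = both e 0F 2F (s≤s z≤n) p r

-- Counting

-- Positions beyond the end of the word read as ◇.
at : Vec Letter N → ℕ → Letter
at []      _       = ◇
at (x ∷ u) zero    = x
at (x ∷ u) (suc p) = at u p

lookup≡at : ∀ (u : Vec Letter N) i → lookup u i ≡ at u (toℕ i)
lookup≡at (x ∷ u) zero    = refl
lookup≡at (x ∷ u) (suc i) = lookup≡at u i

factor≡at : ∀ (u : Vec Letter N) (i : Position n N) j →
  lookup (factor u i) j ≡ at u (Position.start i + toℕ j)
factor≡at u (position i i+n≤N) j = begin
  lookup (factor u (position i i+n≤N)) j          ≡⟨ lookup∘tabulate _ j ⟩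
  lookup u (Fin.inject≤ (i Fin.↑ʳ j) i+n≤N)       ≡⟨ lookup≡at u _ ⟩
  at u (toℕ (Fin.inject≤ (i Fin.↑ʳ j) i+n≤N))     ≡⟨ cong (at u) (Fin.toℕ-inject≤ _ i+n≤N) ⟩
  at u (toℕ (i Fin.↑ʳ j))                         ≡⟨ cong (at u) (Fin.toℕ-↑ʳ i j) ⟩
  at u (i + toℕ j)                                ∎
  where open ≡-Reasoning

-- The irrelevant bound is recovered from the decidability of `≤`.
start+n≤N : (i : Position n N) → Position.start i + n ≤ N
start+n≤N (position i i+n≤N) = recompute (_ ≤? _) i+n≤N

start-injective : {i j : Position n N} → Position.start i ≡ Position.start j → i ≡ j
start-injective refl = refl

-- An enumeration of the diamonds by `Fin (#◇ u)`. The condition `p < N` excludes the default `◇`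
-- that `at` returns past the end.
diamonds : (u : Vec Letter N) →
  Σ (Fin (#◇ u) → ℕ) λ pos → ∀ p → p < N → at u p ≡ ◇ → ∃ λ r → pos r ≡ p
diamonds []      = (λ ()) , λ _ ()
diamonds (x ∷ u) with diamonds u
diamonds (◇ ∷ u)     | pos , onto = pos′ , onto′
  where
  pos′ : Fin (suc (#◇ u)) → ℕ
  pos′ zero    = 0
  pos′ (suc r) = suc (pos r)

  onto′ : ∀ p → p < suc _ → at (◇ ∷ u) p ≡ ◇ → ∃ λ r → pos′ r ≡ p
  onto′ zero    _         _  = zero , refl
  onto′ (suc p) (s≤s p<N) eq with r , eq′ ← onto p p<N eq = suc r , cong suc eq′
diamonds (int _ ∷ u) | pos , onto = suc ∘ pos , onto′
  where
  onto′ : ∀ p → p < suc _ → at (int _ ∷ u) p ≡ ◇ → ∃ λ r → suc (pos r) ≡ p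
  onto′ (suc p) (s≤s p<N) eq with r , eq′ ← onto p p<N eq = r , cong suc eq′

at-most-#◇ : (u : Vec Letter N) (g : Fin (suc (#◇ u)) → ℕ) → Injective _≡_ _≡_ g →
  (∀ r → g r < N) → ¬ (∀ r → at u (g r) ≡ ◇)
at-most-#◇ u g g-inj g<N all◇ = <-irrefl refl (injective⇒≤ {f = rank} rank-injective)
  where
  found : ∀ r → ∃ λ r′ → proj₁ (diamonds u) r′ ≡ g r
  found r = proj₂ (diamonds u) (g r) (g<N r) (all◇ r)

  rank : Fin (suc (#◇ u)) → Fin (#◇ u)
  rank r = proj₁ (found r)

  rank-injective : Injective _≡_ _≡_ rank
  rank-injective {r} {r′} eq = g-inj $
    trans (sym (proj₂ (found r))) (trans (cong (proj₁ (diamonds u)) eq) (proj₂ (found r′)))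

-- Lehmer codes, and permutations determined by their values at diamonds

lehmer : ∀ n → Fin (n !) → Permutation′ n
lehmer zero    _ = idₚ
lehmer (suc n) c = insert zero (quotient (n !) c) (lehmer n (remainder {suc n} (n !) c))

lehmer-injective : ∀ n c d → lehmer n c ≈ₚ lehmer n d → c ≡ d
lehmer-injective zero    zero zero _  = refl
lehmer-injective (suc n) c    d    eq =
  trans (sym (combine-remQuot {suc n} (n !) c))
    (trans (cong₂ combine q≡ r≡) (combine-remQuot {suc n} (n !) d))
  where
  qc = quotient {suc n} (n !) c
  qd = quotient {suc n} (n !) d
  rc = remainder {suc n} (n !) c
  rd = remainder {suc n} (n !) d

  q≡ : qc ≡ qd
  q≡ = eq zero

  r≡ : rc ≡ rd
  r≡ = lehmer-injective n rc rd λ j → punchIn-injective qc _ _ $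
    trans (eq (suc j)) (cong (λ q → punchIn q (lehmer n rd ⟨$⟩ʳ j)) (sym q≡))

-- Strong induction on the value of π at j: were π j < σ j, then σ would take
-- the value π j at some k with π k < π j, where π and σ already agree.
covers-determined : (w : Word n) {π σ : Permutation′ n} → w covers π → w covers σ →
  (∀ j → w j ≡ ◇ → π ⟨$⟩ʳ j ≡ σ ⟨$⟩ʳ j) → π ≈ₚ σ
covers-determined {n} w {π} {σ} covπ covσ agree j = <-rec P step (toℕ (π ⟨$⟩ʳ j)) j refl
  where
  P : ℕ → Set
  P v = ∀ j → toℕ (π ⟨$⟩ʳ j) ≡ v → π ⟨$⟩ʳ j ≡ σ ⟨$⟩ʳ j

  step : ∀ v → (∀ {v′} → v′ < v → P v′) → P v
  step v ih j refl with <-cmp (toℕ (π ⟨$⟩ʳ j)) (toℕ (σ ⟨$⟩ʳ j))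
  ... | tri≈ _ eq _ = toℕ-injective eq
  -- Here `π` takes the smaller value `σ j` at `k`, where the induction hypothesis applies: σ k = π
  -- k = σ j forces k = j.
  ... | tri> _ _ σj<πj = contradiction (subst (λ i → toℕ (σ ⟨$⟩ʳ j) < toℕ (π ⟨$⟩ʳ i)) (sym k≡j) σj<πj)
                           (<-irrefl (cong toℕ (sym πk≡σj)))
    where
    k : Fin n
    k = π ⟨$⟩ˡ (σ ⟨$⟩ʳ j)

    πk≡σj : π ⟨$⟩ʳ k ≡ σ ⟨$⟩ʳ j
    πk≡σj = inverseʳ π

    σk≡σj : σ ⟨$⟩ʳ k ≡ σ ⟨$⟩ʳ j
    σk≡σj = trans (sym (ih σj<πj k (cong toℕ πk≡σj))) πk≡σj

    k≡j : k ≡ j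
    k≡j = trans (sym (inverseˡ σ)) (trans (cong (σ ⟨$⟩ˡ_) σk≡σj) (inverseˡ σ))
  ... | tri< πj<σj _ _ with w j in wj | w (σ ⟨$⟩ˡ (π ⟨$⟩ʳ j)) in wk
  ...   | ◇     | _     = agree j wj
  -- With a diamond at `k`, π k = σ k = π j, so k = j and π j = σ j.
  ...   | int a | ◇     = contradiction πj<σj (<-irrefl (cong toℕ (trans (sym (inverseʳ σ)) (cong (σ ⟨$⟩ʳ_) k≡j))))
    where
    k : Fin n
    k = σ ⟨$⟩ˡ (π ⟨$⟩ʳ j)

    k≡j : k ≡ j
    k≡j = trans (sym (inverseˡ π)) (trans (cong (π ⟨$⟩ˡ_) (trans (agree k wk) (inverseʳ σ))) (inverseˡ π))
  ...   | int a | int b = contradiction πk<πj (<-irrefl (cong toℕ (trans (ih πk<πj k refl) (inverseʳ σ))))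
    where
    k : Fin n
    k = σ ⟨$⟩ˡ (π ⟨$⟩ʳ j)

    πk<πj : π ⟨$⟩ʳ k Fin.< π ⟨$⟩ʳ j
    πk<πj = to (covπ k j b a wk wj) $
      from (covσ k j b a wk wj) (subst (Fin._< (σ ⟨$⟩ʳ j)) (sym (inverseʳ σ)) πj<σj)

-- At b = 0 this is n ^ n ≤ n ! * n !.
power≤factorials : ∀ a b → (a + b) ^ a * b ! ≤ a ! * (a + b) !
power≤factorials zero    b = ≤-refl
power≤factorials (suc a) b = begin
  (s * s ^ a) * b !                 ≤⟨ *-monoˡ-≤ (b !) (*-monoˡ-≤ (s ^ a) s≤) ⟩
  (suc a * suc b * s ^ a) * b !     ≡⟨ shuffle (suc a) (suc b) (s ^ a) (b !) ⟩
  suc a * (s ^ a * suc b !)         ≤⟨ *-monoʳ-≤ (suc a) ih ⟩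
  suc a * (a ! * s !)               ≡⟨ *-assoc (suc a) (a !) (s !) ⟨
  suc a ! * s !                     ∎
  where
  open ≤-Reasoning
  s = suc a + b

  shuffle : ∀ x y z w → (x * y * z) * w ≡ x * (z * (y * w))
  shuffle = solve-∀

  -- The classical pairing i(n + 1 - i) ≥ n of the factors of (n!)², with n = `s` and i = `suc a`.
  s≤ : s ≤ suc a * suc b
  s≤ = subst (s ≤_) (expand a b) (m≤m+n s (a * b))
    where
    expand : ∀ a b → suc a + b + a * b ≡ suc a * suc b
    expand = solve-∀

  ih : s ^ a * suc b ! ≤ a ! * s !
  ih = subst (λ s → s ^ a * suc b ! ≤ a ! * s !) (+-suc a b) (power≤factorials a (suc b))

-- For f ≥ 2 this is f² < n² ≤ n^f; for f = 1 it is the hypothesis f < n.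
f²<n^f : ∀ f → 1 ≤ f → f < n → f * f < n ^ f
f²<n^f {n} (suc zero)    _ f<n = subst (1 <_) (sym (*-identityʳ n)) f<n
f²<n^f {n} (suc (suc f)) _ f<n = <-≤-trans (*-mono-< f<n f<n)
  (subst (_≤ n ^ suc (suc f)) (cong (n *_) (*-identityʳ n))
    (^-monoʳ-≤ n {{>-nonZero (≤-trans (s≤s z≤n) f<n)}} (s≤s (s≤s (z≤n {f})))))

-- After squaring, the left side is f² n^(2f+2), and the spare factor n^f in n^(3f+2) beats f².
factorial-large : ∀ f → 1 ≤ f → 3 * f + 2 ≤ n → f * n * n ^ f < n !
factorial-large {n} f 1≤f 3f+2≤n = ≰⇒> λ n!≤ → <-irrefl refl $ begin-strict
  X * X                              ≡⟨ shuffle f n (n ^ f) ⟩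
  f * f * (n ^ f * n ^ f * (n * n))  <⟨ *-monoˡ-< _ {{nz}} (f²<n^f f 1≤f f<n) ⟩
  n ^ f * (n ^ f * n ^ f * (n * n))  ≡⟨ powers ⟨
  n ^ (3 * f + 2)                    ≤⟨ ^-monoʳ-≤ n {{n≢0}} 3f+2≤n ⟩
  n ^ n                              ≡⟨ cong (_^ n) (+-identityʳ n) ⟨
  (n + 0) ^ n                        ≡⟨ *-identityʳ _ ⟨
  (n + 0) ^ n * 0 !                  ≤⟨ power≤factorials n 0 ⟩
  n ! * (n + 0) !                    ≡⟨ cong (λ m → n ! * m !) (+-identityʳ n) ⟩
  n ! * n !                          ≤⟨ *-mono-≤ n!≤ n!≤ ⟩
  X * X                              ∎
  where
  open ≤-Reasoning
  X = f * n * n ^ f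

  f<n : f < n
  f<n = ≤-trans (subst (suc f ≤_) (expand f) (m≤m+n (suc f) (2 * f + 1))) 3f+2≤n
    where
    expand : ∀ f → suc f + (2 * f + 1) ≡ 3 * f + 2
    expand = solve-∀

  n≢0 : NonZero n
  n≢0 = >-nonZero (≤-trans (s≤s z≤n) f<n)

  nz : NonZero (n ^ f * n ^ f * (n * n))
  nz = m*n≢0 _ _ {{m*n≢0 _ _ {{m^n≢0 n f {{n≢0}}}} {{m^n≢0 n f {{n≢0}}}}}} {{m*n≢0 n n {{n≢0}} {{n≢0}}}}

  shuffle : ∀ f n p → (f * n * p) * (f * n * p) ≡ f * f * (p * p * (n * n))
  shuffle = solve-∀

  powers : n ^ (3 * f + 2) ≡ n ^ f * (n ^ f * n ^ f * (n * n))
  powers = begin-equality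
    n ^ (3 * f + 2)                      ≡⟨ cong (n ^_) (expand f) ⟩
    n ^ (f + (f + f + 2))                ≡⟨ ^-distribˡ-+-* n f _ ⟩
    n ^ f * n ^ (f + f + 2)              ≡⟨ cong (n ^ f *_) (^-distribˡ-+-* n (f + f) 2) ⟩
    n ^ f * (n ^ (f + f) * n ^ 2)        ≡⟨ cong (n ^ f *_) (cong₂ _*_ (^-distribˡ-+-* n f f) (cong (n *_) (*-identityʳ n))) ⟩
    n ^ f * (n ^ f * n ^ f * (n * n))    ∎
    where
    expand : ∀ f → 3 * f + 2 ≡ f + (f + f + 2)
    expand = solve-∀

-- Factors of a u-p-word

module _ {k N} (u : Vec Letter N) (up : IsUPWord (suc k) u) where
  open IsUPWord up

  private
    f = #◇ u
    n′ = suc k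
    Pos = Position n′ N

    start : Pos → ℕ
    start = Position.start

    W : Pos → Word n′
    W i = lookup (factor u i)

  covering : ∀ π → ∃ λ i → W i covers π
  covering π with i , cov , _ ← coveredOnce π = i , cov

  unique : ∀ π {i j} → W i covers π → W j covers π → i ≡ j
  unique π covi covj with _ , _ , uniq ← coveredOnce π = trans (sym (uniq covi)) (uniq covj)

  in-range : ∀ (i : Pos) (j : Fin n′) → start i + toℕ j < N
  in-range i j = <-≤-trans (+-monoʳ-< (start i) (toℕ<n j)) (start+n≤N i)

  1≤f : 1 ≤ f
  1≤f with r , _ ← proj₂ (diamonds u) _ (toℕ<n (index containsDiamond))
             (trans (sym (lookup≡at u _)) (sym (lookup-index containsDiamond)))
    = ≤-trans (s≤s z≤n) (toℕ<n r)

  few : ∀ i (g : Fin (suc f) → Fin n′) → Injective _≡_ _≡_ g → ¬ (∀ r → W i (g r) ≡ ◇)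
  few i g g-inj all◇ = at-most-#◇ u (λ r → start i + toℕ (g r))
    (g-inj ∘ toℕ-injective ∘ +-cancelˡ-≡ (start i) _ _)
    (λ r → in-range i (g r))
    (λ r → trans (sym (factor≡at u i (g r))) (all◇ r))

  -- A permutation is coded by the start of its covering factor together with one value for each
  -- diamond of `u`, and `covers-determined` decodes it.
  factorial-bound : ∀ M → (∀ (i : Pos) → start i < M) → n′ ! ≤ M * n′ ^ f
  factorial-bound M start<M = injective⇒≤ {f = code} code-injective
    where
    pos : Fin f → ℕ
    pos = proj₁ (diamonds u)

    π : Fin (n′ !) → Permutation′ n′
    π = lehmer n′

    i : Fin (n′ !) → Pos
    i c = proj₁ (covering (π c))

    -- For a diamond inside the factor this is the value there; for the others, truncated
    -- subtraction and `mod` merely supply some position.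
    values : Fin (n′ !) → Fin f → Fin n′
    values c r = π c ⟨$⟩ʳ ((pos r ∸ start (i c)) mod n′)

    code : Fin (n′ !) → Fin (M * n′ ^ f)
    code c = combine (fromℕ< (start<M (i c))) (funToFin (values c))

    values-at : ∀ c r j → pos r ≡ start (i c) + toℕ j → values c r ≡ π c ⟨$⟩ʳ j
    values-at c r j eq = cong (π c ⟨$⟩ʳ_) $ toℕ-injective $ begin
      toℕ ((pos r ∸ start (i c)) mod n′)  ≡⟨ toℕ-fromℕ< _ ⟩
      (pos r ∸ start (i c)) % n′          ≡⟨ cong (λ p → (p ∸ start (i c)) % n′) eq ⟩
      (start (i c) + toℕ j ∸ start (i c)) % n′ ≡⟨ cong (_% n′) (m+n∸m≡n (start (i c)) (toℕ j)) ⟩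
      toℕ j % n′                          ≡⟨ m<n⇒m%n≡m (toℕ<n j) ⟩
      toℕ j                               ∎
      where open ≡-Reasoning

    code-injective : Injective _≡_ _≡_ code
    code-injective {c} {d} eq = lehmer-injective n′ c d $
      covers-determined (W (i c)) {π c} {π d} (proj₂ (covering (π c)))
        (subst (λ i → W i covers π d) (sym ic≡id) (proj₂ (covering (π d)))) agree
      where
      both = combine-injective (fromℕ< (start<M (i c))) (funToFin (values c))
               (fromℕ< (start<M (i d))) (funToFin (values d)) eq

      start≡ : start (i c) ≡ start (i d)
      start≡ = fromℕ<-injective _ _ (start<M (i c)) (start<M (i d)) (proj₁ both)

      ic≡id : i c ≡ i d
      ic≡id = start-injective start≡

      values≡ : ∀ r → values c r ≡ values d r
      values≡ r = trans (sym (finToFun-funToFin (values c) r))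
        (trans (cong (λ x → finToFun x r) (proj₂ both)) (finToFun-funToFin (values d) r))

      agree : ∀ j → W (i c) j ≡ ◇ → π c ⟨$⟩ʳ j ≡ π d ⟨$⟩ʳ j
      agree j wj
        with r , eq ← proj₂ (diamonds u) _ (in-range (i c) j) (trans (sym (factor≡at u (i c) j)) wj)
        = trans (sym (values-at c r j eq))
            (trans (values≡ r) (values-at d r j (trans eq (cong (_+ toℕ j) start≡))))

  -- Periodicity of the diamonds and the length of u

  module _ (f-small : suc f + suc f ≤ k) where

    last = fromℕ k

    shift : ∀ (i i′ : Pos) → start i′ ≡ suc (start i) →
      W i ∘ punchIn zero ≗ W i′ ∘ punchIn last
    shift i i′ eq j = begin
      W i (suc j)                              ≡⟨ factor≡at u i (suc j) ⟩
      at u (start i + suc (toℕ j))             ≡⟨ cong (at u) (+-suc (start i) (toℕ j)) ⟩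
      at u (suc (start i) + toℕ j)             ≡⟨ cong₂ (λ p q → at u (p + q)) eq (punchIn-below last j j<last) ⟨
      at u (start i′ + toℕ (punchIn last j))   ≡⟨ factor≡at u i′ _ ⟨
      W i′ (punchIn last j)                    ∎
      where
      open ≡-Reasoning
      j<last : toℕ j < toℕ last
      j<last = subst (toℕ j <_) (sym (toℕ-fromℕ k)) (toℕ<n j)

    W-zero : ∀ i → W i zero ≡ at u (start i)
    W-zero i = trans (factor≡at u i zero) (cong (at u) (+-identityʳ (start i)))

    W-last : ∀ i {p} → start i ≡ suc p → W i last ≡ at u (p + n′)
    W-last i {p} refl = trans (factor≡at u i last)
      (cong (at u) (trans (cong (suc p +_) (toℕ-fromℕ k)) (sym (+-suc p k))))

    diamond-backward : ∀ p → p + n′ < N → at u (p + n′) ≡ ◇ → at u p ≡ ◇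
    diamond-backward p p+n<N up+n≡◇ = trans (sym (W-zero x)) $
      diamond-propagates W distinctIntegers covering unique few f-small zero last x x′ e
        (shift x x′ refl) (trans (W-last x′ refl) up+n≡◇) next
      where
      x x′ e : Pos
      x  = position p (<⇒≤ p+n<N)
      x′ = position (suc p) p+n<N
      -- The final factor is the only one without a successor.
      e  = position (N ∸ n′) (≤-reflexive (m∸n+n≡m n≤N))

      next : ∀ i → i ≡ e ⊎ ∃ λ i′ → (W i ∘ punchIn zero ≗ W i′ ∘ punchIn last) × (i′ ≡ x′ → i ≡ x)
      next i with m≤n⇒m<n∨m≡n (start+n≤N i)
      ... | inj₁ i+n<N = inj₂ (i′ , shift i i′ refl , start-injective ∘ suc-injective ∘ cong start)
        where
        i′ : Pos
        i′ = position (suc (start i)) i+n<N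
      ... | inj₂ i+n≡N = inj₁ (start-injective (trans (sym (m+n∸n≡m (start i) n′)) (cong (_∸ n′) i+n≡N)))

    diamond-forward : ∀ p → p + n′ < N → at u p ≡ ◇ → at u (p + n′) ≡ ◇
    diamond-forward p p+n<N up≡◇ = trans (sym (W-last x refl)) $
      diamond-propagates W distinctIntegers covering unique few f-small last zero x x′ e
        (sym ∘ shift x′ x refl) (trans (W-zero x′) up≡◇) next
      where
      x x′ e : Pos
      x  = position (suc p) p+n<N
      x′ = position p (<⇒≤ p+n<N)
      -- Now neighbours are predecessors, and the initial factor has none.
      e  = position 0 n≤N

      next : ∀ i → i ≡ e ⊎ ∃ λ i′ → (W i ∘ punchIn last ≗ W i′ ∘ punchIn zero) × (i′ ≡ x′ → i ≡ x)
      next (position zero    _)   = inj₁ refl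
      next (position (suc i) fits) = inj₂
        (position i (<⇒≤ i+n<N) , sym ∘ shift _ _ refl , start-injective ∘ cong suc ∘ cong start)
        where
        i+n<N : i + n′ < N
        i+n<N = recompute (_ ≤? _) fits

    next-period : ∀ q r → r + suc q * n′ ≡ (r + q * n′) + n′
    next-period q r = trans (cong (r +_) (+-comm n′ (q * n′))) (sym (+-assoc r (q * n′) n′))

    diamond-reduces : ∀ q r → r + q * n′ < N → at u (r + q * n′) ≡ ◇ → at u r ≡ ◇
    diamond-reduces zero    r _ eq = trans (cong (at u) (sym (+-identityʳ r))) eq
    diamond-reduces (suc q) r lt eq = diamond-reduces q r (<-trans (m<m+n _ z<s) lt′)
      (diamond-backward _ lt′ (trans (cong (at u) (sym (next-period q r))) eq))
      where
      lt′ : (r + q * n′) + n′ < N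
      lt′ = subst (_< N) (next-period q r) lt

    diamond-repeats : ∀ q r → r + q * n′ < N → at u r ≡ ◇ → at u (r + q * n′) ≡ ◇
    diamond-repeats zero    r _ eq = trans (cong (at u) (+-identityʳ r)) eq
    diamond-repeats (suc q) r lt eq = trans (cong (at u) (next-period q r))
      (diamond-forward _ lt′ (diamond-repeats q r (<-trans (m<m+n _ z<s) lt′) eq))
      where
      lt′ : (r + q * n′) + n′ < N
      lt′ = subst (_< N) (next-period q r) lt

    -- Reduce a diamond to its residue `r` modulo `n′`. In a longer word, r, r + n, ..., r + fn
    -- would all carry diamonds, which makes f + 1 of them.
    length-bound : N < suc f * n′
    length-bound = ≰⇒> λ long → at-most-#◇ u g g-injective (g<N long)
      λ q → diamond-repeats (toℕ q) r (g<N long q) ur≡◇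
      where
      p = toℕ (index containsDiamond)
      r = p % n′

      g : Fin (suc f) → ℕ
      g q = r + toℕ q * n′

      g-injective : Injective _≡_ _≡_ g
      g-injective = toℕ-injective ∘ *-cancelʳ-≡ _ _ n′ ∘ +-cancelˡ-≡ r _ _

      g<N : suc f * n′ ≤ N → ∀ q → g q < N
      g<N long q = <-≤-trans (+-monoˡ-< (toℕ q * n′) (m%n<n p n′))
        (≤-trans (*-monoˡ-≤ n′ (toℕ<n q)) long)

      p≡ : p ≡ r + (p / n′) * n′
      p≡ = m≡m%n+[m/n]*n p n′

      ur≡◇ : at u r ≡ ◇
      ur≡◇ = diamond-reduces (p / n′) r (subst (_< N) p≡ (toℕ<n (index containsDiamond)))
        (trans (cong (at u) (sym p≡))
          (trans (sym (lookup≡at u _)) (sym (lookup-index containsDiamond))))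

    start-bound : ∀ (i : Pos) → start i < f * n′
    start-bound i = +-cancelʳ-< n′ _ _ $
      subst (start i + n′ <_) (+-comm n′ (f * n′)) (≤-<-trans (start+n≤N i) length-bound)

theorem4 : ∀ (n N : ℕ) (u : Vec Letter N) → IsUPWord n u → ¬ Trivial u → n ≤ 3 * #◇ u + 1
theorem4 zero    N u up _ = z≤n
theorem4 (suc k) N u up _ = ≮⇒≥ λ large →
  let 3f+2≤n  = subst (_≤ suc k) (sym (+-suc (3 * f) 1)) large
      f-small = ≤-pred (≤-trans (room f (1≤f u up)) 3f+2≤n)
  in <⇒≱ (factorial-large f (1≤f u up) 3f+2≤n)
       (factorial-bound u up (f * suc k) (start-bound u up f-small))
  where
  f = #◇ u

  -- 2f + 3 ≤ 3f + 2 uses f ≥ 1; dropping one from each side of 2f + 3 ≤ n = k + 1 gives `f-small`.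
  room : ∀ f → 1 ≤ f → suc (suc f + suc f) ≤ 3 * f + 2
  room f 1≤f = subst (_≤ 3 * f + 2) (lhs f) (subst (2 * f + 2 + 1 ≤_) (rhs f) (+-monoʳ-≤ (2 * f + 2) 1≤f))
    where
    lhs : ∀ f → 2 * f + 2 + 1 ≡ suc (suc f + suc f)
    lhs = solve-∀
    rhs : ∀ f → 2 * f + 2 + f ≡ 3 * f + 2
    rhs = solve-∀
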